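{- For any scaling $(K_n,P_n)_{n\ge 1}$ with $\theta_n=(K_n,P_n)$ such that $\lim_{n\to\infty} n^3\,\tau(\theta_n)=0$, we have $$\lim_{n\to\infty}\mathbb{P}\left[\mathbb{K}(n;\theta_n)\text{ contains at least one triangle}\right]=0 .$$
   Context: Random key graph: for positive integers $K\le P$ write $\theta=(K,P)$, and let $K_1(\theta),\dots,K_n(\theta)$ be i.i.d. random subsets, each uniformly distributed over the $K$-element subsets of a fixed set of $P$ keys. The random key graph $\mathbb{K}(n;\theta)$ has vertex set $\{1,\dots,n\}$, and distinct nodes $i,j$ are adjacent iff $K_i(\theta)\cap K_j(\theta)\neq\emptyset$. Define $\tau(\theta)=\frac{K^3}{P^2}+\left(\frac{K^2}{P}\right)^3$. A scaling is a pair of sequences $K,P$ of positive integers, with values denoted $K_n,P_n$ ($n=1,2,\dots$), such that $K_n\le P_n$ for all $n=2,3,\dots$; one writes $\theta_n=(K_n,P_n)$. -}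

module Defs where

open import Level using (0ℓ)
open import Data.Bool.Base using (if_then_else_)
open import Data.Fin.Base using (Fin)
import Data.Fin.Properties as Fin
open import Data.Fin.Subset using (Subset; inside; outside; _∩_; Nonempty; ∣_∣)
open import Data.Fin.Subset.Properties using (nonempty?)
import Data.Integer.Base as ℤ
open import Data.List.Base as List using (List; []; _∷_; cartesianProductWith)
open import Data.Nat.Base as ℕ using (ℕ; zero; suc; NonZero; z≤n; s≤s; >-nonZero; >-nonZero⁻¹)
open import Data.Nat.Combinatorics using (_C_; nCk+nC[k+1]≡[n+1]C[k+1])
import Data.Nat.Properties as ℕ
open import Data.Product.Base using (∃-syntax; _×_)
open import Data.Rational.Base using (ℚ; 0ℚ; 1ℚ; _+_; _*_; _-_; _/_; _<_; +-*-rawSemiring)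
  renaming (∣_∣ to abs)
open import Data.Vec.Base as Vec using (Vec; []; _∷_; lookup)
open import Algebra.Definitions.RawSemiring +-*-rawSemiring using (_^_)
open import Relation.Binary.Core using (Rel)
import Relation.Binary.Definitions as Binary
open import Relation.Binary.PropositionalEquality using (_≡_; _≢_; subst)
open import Relation.Nullary.Decidable using (Dec; does; _×-dec_; ¬?)
open import Relation.Unary using (Pred; Decidable)

record Params : Set where
  constructor mkParams
  field
    K P     : ℕ
    {{K≢0}} : NonZero K
    {{P≢0}} : NonZero P
    K≤P     : K ℕ.≤ P

nCk≢0 : ∀ {n k} → k ℕ.≤ n → NonZero (n C k)
nCk≢0 z≤n = _
nCk≢0 (s≤s {k} {n} k≤n) = >-nonZero (subst (0 ℕ.<_) (nCk+nC[k+1]≡[n+1]C[k+1] n k)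
  (ℕ.≤-trans (>-nonZero⁻¹ (n C k) {{nCk≢0 k≤n}}) (ℕ.m≤m+n (n C k) (n C suc k))))

τ : Params → ℚ
τ θ = ℤ.+ (K ℕ.^ 3) / (P ℕ.^ 2) + (ℤ.+ (K ℕ.^ 2) / P) ^ 3
  where
  open Params θ
  instance
    P²≢0 : NonZero (P ℕ.^ 2)
    P²≢0 = ℕ.m^n≢0 P 2

-- All vectors with entries drawn from a list, each exactly once if the list
-- has no repetitions.
tuples : ∀ {A : Set} → List A → ∀ n → List (Vec A n)
tuples xs zero    = [] ∷ []
tuples xs (suc n) = cartesianProductWith _∷_ xs (tuples xs n)

subsets : ∀ p → List (Subset p)
subsets = tuples (inside ∷ outside ∷ [])

module _ (θ : Params) where
  open Params θ

  -- An outcome assigns a set of keys to each of the n nodes.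
  Outcome : ℕ → Set
  Outcome n = Vec (Subset P) n

  outcomes : ∀ n → List (Outcome n)
  outcomes = tuples (subsets P)

  -- Probability mass function of the uniform distribution on the K-element
  -- sets of keys.
  keyMass : Subset P → ℚ
  keyMass S = if does (∣ S ∣ ℕ.≟ K)
              then (ℤ.1ℤ / (P C K)) {{nCk≢0 K≤P}}
              else 0ℚ

  -- Independence: the joint mass function is the product of the marginals.
  mass : ∀ {n} → Outcome n → ℚ
  mass ω = Vec.foldr (λ _ → ℚ) _*_ 1ℚ (Vec.map keyMass ω)

  ℙ : ∀ {n} {E : Pred (Outcome n) 0ℓ} → Decidable E → ℚ
  ℙ {n} E? = List.foldr _+_ 0ℚ
    (List.map (λ ω → if does (E? ω) then mass ω else 0ℚ) (outcomes n))

-- Adjacency in the random key graph, for one outcome of the key sets.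
KeyGraph : ∀ {p n} → Vec (Subset p) n → Rel (Fin n) 0ℓ
KeyGraph ω i j = i ≢ j × Nonempty (lookup ω i ∩ lookup ω j)

keyGraph? : ∀ {p n} (ω : Vec (Subset p) n) → Binary.Decidable (KeyGraph ω)
keyGraph? ω i j = ¬? (i Fin.≟ j) ×-dec nonempty? (lookup ω i ∩ lookup ω j)

-- For a simple graph the three vertices are distinct, adjacency being
-- irreflexive.
HasTriangle : ∀ {n} → Rel (Fin n) 0ℓ → Set
HasTriangle _~_ = ∃[ i ] ∃[ j ] ∃[ k ] i ~ j × j ~ k × i ~ k

hasTriangle? : ∀ {n} {_~_ : Rel (Fin n) 0ℓ} → Binary.Decidable _~_ → Dec (HasTriangle _~_)
hasTriangle? _~?_ = Fin.any? λ i → Fin.any? λ j → Fin.any? λ k →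
  (i ~? j) ×-dec (j ~? k) ×-dec (i ~? k)

ℙ[triangle] : ℕ → Params → ℚ
ℙ[triangle] n θ = ℙ θ {n} (λ ω → hasTriangle? (keyGraph? ω))

-- Sequences are indexed by n = 1, 2, …; the values at 0 are unconstrained and
-- never used.
record Scaling : Set where
  field
    K P   : ℕ → ℕ
    K≢0   : ∀ n → 1 ℕ.≤ n → NonZero (K n)
    P≢0   : ∀ n → 1 ℕ.≤ n → NonZero (P n)
    K≤P   : ∀ n → 2 ℕ.≤ n → K n ℕ.≤ P n

  θ : ∀ n → 2 ℕ.≤ n → Params
  θ n 2≤n = mkParams (K n) (P n) {{K≢0 n 1≤n}} {{P≢0 n 1≤n}} (K≤P n 2≤n)
    where 1≤n = ℕ.<⇒≤ 2≤n

-- Indexed by n = 2, 3, …, where K n ≤ P n is guaranteed; omitting n = 1 does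
-- not affect a limit.  Terms and limit are rational, so rational ε suffice.
_ConvergesTo_ : (∀ n → 2 ℕ.≤ n → ℚ) → ℚ → Set
a ConvergesTo ℓ = ∀ (ε : ℚ) → 0ℚ < ε →
  ∃[ N ] ∀ n (2≤n : 2 ℕ.≤ n) → N ℕ.≤ n → abs (a n 2≤n - ℓ) < ε

{-# OPTIONS --safe #-}
-- A union bound over triples of nodes gives ℙ[triangle] ≤ n³ β, where β is the
-- probability of a triangle on three given nodes.  Such a triangle is witnessed
-- by a key on each edge: either one key is held by all three nodes, which has
-- probability at most P (K/P)³ = K³/P², or three distinct keys are each held by
-- both ends of an edge, so that every node holds a prescribed pair of keys, which
-- has probability at most P³ ((K/P)²)³ = (K²/P)³.  Hence β ≤ τ(θ).
module Submission where

open import Defs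
open import Data.Nat.Base as ℕ using (ℕ)
open import Data.Integer.Base using (+_)
open import Data.Rational.Base using (0ℚ; _*_; _/_)

open import Data.Bool.Base using (Bool; true; false; if_then_else_)
open import Data.Fin.Base using (Fin; zero; suc; punchOut)
import Data.Fin.Properties as Fin
open import Data.Fin.Subset using (Subset; inside; outside; _∈_; ∣_∣)
open import Data.Fin.Subset.Properties using (_∈?_; x∈p∩q⁻)
import Data.Integer.Base as ℤ
import Data.Integer.Properties as ℤ
open import Data.List.Base as List using (List; []; _∷_; _++_; cartesianProductWith)
open import Data.Nat.Base using (zero; suc; NonZero; z≤n; s≤s)
open import Data.Nat.Combinatorics using (_C_; nC1≡n; nCk+nC[k+1]≡[n+1]C[k+1]; k>n⇒nCk≡0)
import Data.Nat.Properties as ℕ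
import Data.Nat.Tactic.RingSolver as ℕ
open import Data.Product.Base using (∃-syntax; _×_; _,_; proj₁; proj₂)
open import Data.Rational.Base as ℚ using (ℚ; 1ℚ; _+_; _≤_; toℚᵘ)
import Data.Rational.Properties as ℚ
open import Algebra.Definitions.RawSemiring ℚ.+-*-rawSemiring using (_^_)
open import Data.Rational.Solver using (module +-*-Solver)
open import Data.Rational.Unnormalised.Base as ℚᵘ using (mkℚᵘ; *≡*; *≤*)
import Data.Rational.Unnormalised.Properties as ℚᵘ
open import Data.Sum.Base using (_⊎_; inj₁; inj₂)
open import Data.Unit.Base using (⊤; tt)
open import Data.Vec.Base using (Vec; []; _∷_; lookup; insertAt)
open import Data.Vec.Properties using (insertAt-lookup; insertAt-punchIn; lookup⇒[]=; []=⇒lookup)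
open import Function.Base using (_∘_)
open import Function.Bundles using (_⇔_; mk⇔)
open import Level using (0ℓ)
open import Relation.Binary.PropositionalEquality
open import Relation.Nullary using (Dec; yes; no; does; ¬_; contradiction)
open import Relation.Nullary.Decidable using (_×-dec_; _⊎-dec_; ¬?; dec-true; dec-false; does-⇔)
open import Relation.Unary using (Pred; Decidable)

private variable
  A B X : Set
  m n : ℕ

-- Fractions of natural numbers and binomial coefficients.

toℚᵘ-/ : ∀ a b .{{_ : NonZero b}} → toℚᵘ (+ a / b) ℚᵘ.≃ (+ a ℚᵘ./ b)
toℚᵘ-/ a (suc b) = ℚ.toℚᵘ-fromℚᵘ (mkℚᵘ (+ a) b)

-- Because `_/_` reduces to lowest terms, numerators and denominators do not multiply componentwise
-- by computation; in the unnormalised rationals they do, up to `ℤ.pos-*`.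
/-*-/ : ∀ a b c d .{{_ : NonZero b}} .{{_ : NonZero d}} .{{_ : NonZero (b ℕ.* d)}} →
        (+ a / b) * (+ c / d) ≡ + (a ℕ.* c) / (b ℕ.* d)
/-*-/ a b@(suc _) c d@(suc _) = ℚ.toℚᵘ-injective (begin-equality
  toℚᵘ ((+ a / b) * (+ c / d))              ≃⟨ ℚ.toℚᵘ-homo-* (+ a / b) (+ c / d) ⟩
  toℚᵘ (+ a / b) ℚᵘ.* toℚᵘ (+ c / d)        ≃⟨ ℚᵘ.*-cong (toℚᵘ-/ a b) (toℚᵘ-/ c d) ⟩
  (+ a ℚᵘ./ b) ℚᵘ.* (+ c ℚᵘ./ d)            ≃⟨ *≡* (cong (λ z → z ℤ.* + (b ℕ.* d)) (sym (ℤ.pos-* a c))) ⟩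
  + (a ℕ.* c) ℚᵘ./ (b ℕ.* d)                ≃⟨ toℚᵘ-/ (a ℕ.* c) (b ℕ.* d) ⟨
  toℚᵘ (+ (a ℕ.* c) / (b ℕ.* d))            ∎)
  where open ℚᵘ.≤-Reasoning

/-mono-≤ : ∀ a b c d .{{_ : NonZero b}} .{{_ : NonZero d}} →
           a ℕ.* d ℕ.≤ c ℕ.* b → + a / b ≤ + c / d
/-mono-≤ a b@(suc _) c d@(suc _) ad≤cb = ℚ.toℚᵘ-cancel-≤ (begin
  toℚᵘ (+ a / b)  ≃⟨ toℚᵘ-/ a b ⟩
  + a ℚᵘ./ b      ≤⟨ *≤* (subst₂ ℤ._≤_ (ℤ.pos-* a d) (ℤ.pos-* c b) (ℤ.+≤+ ad≤cb)) ⟩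
  + c ℚᵘ./ d      ≃⟨ toℚᵘ-/ c d ⟨
  toℚᵘ (+ c / d)  ∎)
  where open ℚᵘ.≤-Reasoning

/-cross-≡ : ∀ a b c d .{{_ : NonZero b}} .{{_ : NonZero d}} →
            a ℕ.* d ≡ c ℕ.* b → + a / b ≡ + c / d
/-cross-≡ a b c d ad≡cb = ℚ.≤-antisym
  (/-mono-≤ a b c d (ℕ.≤-reflexive ad≡cb)) (/-mono-≤ c d a b (ℕ.≤-reflexive (sym ad≡cb)))

m/1+n/1 : ∀ m n → + m / 1 + + n / 1 ≡ + (m ℕ.+ n) / 1
m/1+n/1 m n = ℚ.toℚᵘ-injective (begin-equality
  toℚᵘ (+ m / 1 + + n / 1)            ≃⟨ ℚ.toℚᵘ-homo-+ (+ m / 1) (+ n / 1) ⟩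
  toℚᵘ (+ m / 1) ℚᵘ.+ toℚᵘ (+ n / 1)  ≃⟨ ℚᵘ.+-cong (toℚᵘ-/ m 1) (toℚᵘ-/ n 1) ⟩
  (+ m ℚᵘ./ 1) ℚᵘ.+ (+ n ℚᵘ./ 1)      ≡⟨ cong₂ (λ x y → (x ℤ.+ y) ℚᵘ./ 1) (ℤ.*-identityʳ (+ m)) (ℤ.*-identityʳ (+ n)) ⟩
  + (m ℕ.+ n) ℚᵘ./ 1                  ≃⟨ toℚᵘ-/ (m ℕ.+ n) 1 ⟨
  toℚᵘ (+ (m ℕ.+ n) / 1)              ∎)
  where open ℚᵘ.≤-Reasoning

0≤/ : ∀ a b .{{_ : NonZero b}} → 0ℚ ≤ + a / b
0≤/ a b = /-mono-≤ 0 1 a b z≤n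

0≤* : ∀ {p q} → 0ℚ ≤ p → 0ℚ ≤ q → 0ℚ ≤ p * q
0≤* {p} {q} 0≤p 0≤q = ℚ.nonNegative⁻¹ (p * q) {{ℚ.nonNeg*nonNeg⇒nonNeg p {{ℚ.nonNegative 0≤p}} q {{ℚ.nonNegative 0≤q}}}}

0≤+ : ∀ {p q} → 0ℚ ≤ p → 0ℚ ≤ q → 0ℚ ≤ p + q
0≤+ = ℚ.+-mono-≤

*-mono-≤ : ∀ {p q r s} → 0ℚ ≤ r → 0ℚ ≤ q → p ≤ q → r ≤ s → p * r ≤ q * s
*-mono-≤ {p} {q} {r} {s} 0≤r 0≤q p≤q r≤s = ℚ.≤-trans
  (ℚ.*-monoʳ-≤-nonNeg r {{ℚ.nonNegative 0≤r}} p≤q)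
  (ℚ.*-monoˡ-≤-nonNeg q {{ℚ.nonNegative 0≤q}} r≤s)

-- Absorption identity, by Pascal's rule: one copy of `c` is set aside, and the rest falls to the
-- induction hypotheses at `k` and `suc k`. It turns the proportion of key sets that hold a given
-- key into `K / P`.
[1+k]*[1+n]C[1+k]≡[1+n]*nCk : ∀ n k → suc k ℕ.* (suc n C suc k) ≡ suc n ℕ.* (n C k)
[1+k]*[1+n]C[1+k]≡[1+n]*nCk zero    zero    = refl
[1+k]*[1+n]C[1+k]≡[1+n]*nCk zero    (suc k) = begin
  suc (suc k) ℕ.* (1 C suc (suc k))  ≡⟨ cong (suc (suc k) ℕ.*_) (k>n⇒nCk≡0 {1} {suc (suc k)} (s≤s (s≤s z≤n))) ⟩
  suc (suc k) ℕ.* 0                  ≡⟨ ℕ.*-zeroʳ (suc (suc k)) ⟩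
  0                                  ≡⟨ cong (ℕ._+ 0) (k>n⇒nCk≡0 {0} {suc k} (s≤s z≤n)) ⟨
  1 ℕ.* (0 C suc k)                  ∎
  where open ≡-Reasoning
[1+k]*[1+n]C[1+k]≡[1+n]*nCk (suc n) zero    = begin
  1 ℕ.* (suc (suc n) C 1)  ≡⟨ ℕ.*-identityˡ (suc (suc n) C 1) ⟩
  suc (suc n) C 1          ≡⟨ nC1≡n (suc (suc n)) ⟩
  suc (suc n)              ≡⟨ ℕ.*-identityʳ (suc (suc n)) ⟨
  suc (suc n) ℕ.* 1        ∎
  where open ≡-Reasoning
[1+k]*[1+n]C[1+k]≡[1+n]*nCk (suc n) (suc k) = begin
  (2 ℕ.+ k) ℕ.* (suc (suc n) C (2 ℕ.+ k))
    ≡⟨ cong ((2 ℕ.+ k) ℕ.*_) (nCk+nC[k+1]≡[n+1]C[k+1] (suc n) (suc k)) ⟨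
  (2 ℕ.+ k) ℕ.* (c ℕ.+ d)
    ≡⟨ ring₁ k c d ⟩
  c ℕ.+ (suc k ℕ.* c ℕ.+ (2 ℕ.+ k) ℕ.* d)
    ≡⟨ cong (c ℕ.+_) (cong₂ ℕ._+_ ([1+k]*[1+n]C[1+k]≡[1+n]*nCk n k) ([1+k]*[1+n]C[1+k]≡[1+n]*nCk n (suc k))) ⟩
  c ℕ.+ (suc n ℕ.* (n C k) ℕ.+ suc n ℕ.* (n C suc k))
    ≡⟨ cong (c ℕ.+_) (ℕ.*-distribˡ-+ (suc n) (n C k) (n C suc k)) ⟨
  c ℕ.+ suc n ℕ.* (n C k ℕ.+ n C suc k)
    ≡⟨ cong (λ z → c ℕ.+ suc n ℕ.* z) (nCk+nC[k+1]≡[n+1]C[k+1] n k) ⟩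
  suc (suc n) ℕ.* c
    ∎
  where
  open ≡-Reasoning
  c = suc n C suc k
  d = suc n C suc (suc k)
  ring₁ : ∀ k c d → (2 ℕ.+ k) ℕ.* (c ℕ.+ d) ≡ c ℕ.+ ((1 ℕ.+ k) ℕ.* c ℕ.+ (2 ℕ.+ k) ℕ.* d)
  ring₁ = ℕ.solve-∀

-- Finite sums over lists and tuples.

∑ : List A → (A → ℚ) → ℚ
∑ xs f = List.foldr _+_ 0ℚ (List.map f xs)

∑-cong : (xs : List A) {f g : A → ℚ} → (∀ x → f x ≡ g x) → ∑ xs f ≡ ∑ xs g
∑-cong []       f≗g = refl
∑-cong (x ∷ xs) f≗g = cong₂ _+_ (f≗g x) (∑-cong xs f≗g)

∑-mono-≤ : (xs : List A) {f g : A → ℚ} → (∀ x → f x ≤ g x) → ∑ xs f ≤ ∑ xs g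
∑-mono-≤ []       f≤g = ℚ.≤-refl
∑-mono-≤ (x ∷ xs) f≤g = ℚ.+-mono-≤ (f≤g x) (∑-mono-≤ xs f≤g)

∑-zero : (xs : List A) → ∑ xs (λ _ → 0ℚ) ≡ 0ℚ
∑-zero []       = refl
∑-zero (x ∷ xs) = trans (ℚ.+-identityˡ _) (∑-zero xs)

∑-distrib-+ : (xs : List A) (f g : A → ℚ) → ∑ xs (λ x → f x + g x) ≡ ∑ xs f + ∑ xs g
∑-distrib-+ []       f g = refl
∑-distrib-+ (x ∷ xs) f g = trans (cong (λ s → f x + g x + s) (∑-distrib-+ xs f g))
  (solve 4 (λ a b c d → a :+ b :+ (c :+ d) := a :+ c :+ (b :+ d)) refl (f x) (g x) (∑ xs f) (∑ xs g))
  where open +-*-Solver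

*-distribˡ-∑ : ∀ c (xs : List A) (f : A → ℚ) → c * ∑ xs f ≡ ∑ xs (λ x → c * f x)
*-distribˡ-∑ c []       f = ℚ.*-zeroʳ c
*-distribˡ-∑ c (x ∷ xs) f = trans (ℚ.*-distribˡ-+ c (f x) (∑ xs f)) (cong (_+_ (c * f x)) (*-distribˡ-∑ c xs f))

*-distribʳ-∑ : ∀ c (xs : List A) (f : A → ℚ) → ∑ xs f * c ≡ ∑ xs (λ x → f x * c)
*-distribʳ-∑ c []       f = ℚ.*-zeroˡ c
*-distribʳ-∑ c (x ∷ xs) f = trans (ℚ.*-distribʳ-+ c (f x) (∑ xs f)) (cong (_+_ (f x * c)) (*-distribʳ-∑ c xs f))

∑-swap : (xs : List A) (ys : List B) (f : A → B → ℚ) →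
         ∑ xs (λ x → ∑ ys (f x)) ≡ ∑ ys (λ y → ∑ xs (λ x → f x y))
∑-swap []       ys f = sym (∑-zero ys)
∑-swap (x ∷ xs) ys f = trans (cong (_+_ (∑ ys (f x))) (∑-swap xs ys f))
  (sym (∑-distrib-+ ys (f x) (λ y → ∑ xs (λ x → f x y))))

∑-++ : (xs ys : List A) (f : A → ℚ) → ∑ (xs ++ ys) f ≡ ∑ xs f + ∑ ys f
∑-++ []       ys f = sym (ℚ.+-identityˡ _)
∑-++ (x ∷ xs) ys f = trans (cong (_+_ (f x)) (∑-++ xs ys f)) (sym (ℚ.+-assoc (f x) (∑ xs f) (∑ ys f)))

∑-map : (h : A → B) (xs : List A) (f : B → ℚ) → ∑ (List.map h xs) f ≡ ∑ xs (f ∘ h)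
∑-map h []       f = refl
∑-map h (x ∷ xs) f = cong (_+_ (f (h x))) (∑-map h xs f)

∑-cartesianProductWith : (h : A → B → X) (xs : List A) (ys : List B) (f : X → ℚ) →
  ∑ (cartesianProductWith h xs ys) f ≡ ∑ xs (λ x → ∑ ys (λ y → f (h x y)))
∑-cartesianProductWith h []       ys f = refl
∑-cartesianProductWith h (x ∷ xs) ys f = trans (∑-++ (List.map (h x) ys) _ f)
  (cong₂ _+_ (∑-map (h x) ys f) (∑-cartesianProductWith h xs ys f))

-- Fubini for an arbitrary coordinate: the head is peeled off, the induction hypothesis extracts
-- coordinate `i` from the tail, and the two outer sums are exchanged. It serves both to split off
-- the key set of one node and to split subsets on one key.
∑-tuples-insertAt : (xs : List A) (i : Fin (suc n)) (f : Vec A (suc n) → ℚ) →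
  ∑ (tuples xs (suc n)) f ≡ ∑ xs (λ x → ∑ (tuples xs n) (λ v → f (insertAt v i x)))
∑-tuples-insertAt {n = n} xs zero f = ∑-cartesianProductWith _∷_ xs (tuples xs n) f
∑-tuples-insertAt {n = suc n} xs (suc i) f = begin
  ∑ (tuples xs (suc (suc n))) f
    ≡⟨ ∑-cartesianProductWith _∷_ xs (tuples xs (suc n)) f ⟩
  ∑ xs (λ y → ∑ (tuples xs (suc n)) (λ v → f (y ∷ v)))
    ≡⟨ ∑-cong xs (λ y → ∑-tuples-insertAt xs i (f ∘ (y ∷_))) ⟩
  ∑ xs (λ y → ∑ xs (λ x → ∑ (tuples xs n) (λ v → f (y ∷ insertAt v i x))))
    ≡⟨ ∑-swap xs xs _ ⟩
  ∑ xs (λ x → ∑ xs (λ y → ∑ (tuples xs n) (λ v → f (y ∷ insertAt v i x))))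
    ≡⟨ ∑-cong xs (λ x → ∑-cartesianProductWith _∷_ xs (tuples xs n) (λ v → f (insertAt v (suc i) x))) ⟨
  ∑ xs (λ x → ∑ (tuples xs (suc n)) (λ v → f (insertAt v (suc i) x)))
    ∎
  where open ≡-Reasoning

lookup-insertAt-≢ : (v : Vec A n) {i j : Fin (suc n)} (x : A) (i≢j : i ≢ j) →
                    lookup (insertAt v i x) j ≡ lookup v (punchOut i≢j)
lookup-insertAt-≢ v {i} x i≢j = trans
  (cong (lookup (insertAt v i x)) (sym (Fin.punchIn-punchOut i≢j)))
  (insertAt-punchIn v i x (punchOut i≢j))

-- Finite measures and union bounds.

module FiniteMeasure {A : Set} (xs : List A) (w : A → ℚ) (0≤w : ∀ x → 0ℚ ≤ w x) where

  restrict : Bool → A → ℚ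
  restrict b x = if b then w x else 0ℚ

  -- For the list `outcomes θ n` and the weight `mass θ` this unfolds to `ℙ θ`, so that the bounds
  -- below apply to `ℙ` without conversion.
  Pr : {E : Pred A 0ℓ} → Decidable E → ℚ
  Pr E? = ∑ xs (λ x → restrict (does (E? x)) x)

  private variable
    E F : Pred A 0ℓ

  0≤restrict : ∀ b x → 0ℚ ≤ restrict b x
  0≤restrict true  x = 0≤w x
  0≤restrict false x = ℚ.≤-refl

  0≤Pr : (E? : Decidable E) → 0ℚ ≤ Pr E?
  0≤Pr E? = subst (_≤ Pr E?) (∑-zero xs) (∑-mono-≤ xs (λ x → 0≤restrict (does (E? x)) x))

  Pr-mono : (E? : Decidable E) (F? : Decidable F) → (∀ {x} → E x → F x) → Pr E? ≤ Pr F?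
  Pr-mono E? F? E⊆F = ∑-mono-≤ xs pointwise
    where
    pointwise : ∀ x → restrict (does (E? x)) x ≤ restrict (does (F? x)) x
    pointwise x with E? x
    ... | no  _  = 0≤restrict (does (F? x)) x
    ... | yes ex rewrite dec-true (F? x) (E⊆F ex) = ℚ.≤-refl

  Pr-∅ : (E? : Decidable E) → (∀ {x} → ¬ E x) → Pr E? ≡ 0ℚ
  Pr-∅ E? ¬E = trans (∑-cong xs (λ x → cong (λ b → restrict b x) (dec-false (E? x) ¬E))) (∑-zero xs)

  Pr-∪ : (E? : Decidable E) (F? : Decidable F) →
         Pr (λ x → E? x ⊎-dec F? x) ≤ Pr E? + Pr F?
  Pr-∪ E? F? = ℚ.≤-trans (∑-mono-≤ xs pointwise) (ℚ.≤-reflexive (∑-distrib-+ xs _ _))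
    where
    pointwise : ∀ x → restrict (does (E? x ⊎-dec F? x)) x ≤ restrict (does (E? x)) x + restrict (does (F? x)) x
    pointwise x with does (E? x)
    ... | true  = subst (_≤ w x + restrict (does (F? x)) x) (ℚ.+-identityʳ (w x))
                    (ℚ.+-monoʳ-≤ (w x) (0≤restrict (does (F? x)) x))
    ... | false = ℚ.≤-reflexive (sym (ℚ.+-identityˡ _))

  Pr-∃ : ∀ {E : Fin m → Pred A 0ℓ} (E? : ∀ i → Decidable (E i)) {b} →
         (∀ i → Pr (E? i) ≤ b) → Pr (λ x → Fin.any? (λ i → E? i x)) ≤ + m / 1 * b
  Pr-∃ {m = zero} E? {b} _ = ℚ.≤-reflexive (trans
    (Pr-∅ (λ x → Fin.any? (λ i → E? i x)) (λ { (() , _) })) (sym (ℚ.*-zeroˡ b)))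
  Pr-∃ {m = suc m} {E} E? {b} Pr≤b = begin
    Pr (λ x → Fin.any? (λ i → E? i x))
      ≤⟨ Pr-mono (λ x → Fin.any? (λ i → E? i x)) (λ x → E? zero x ⊎-dec Fin.any? (λ i → E? (suc i) x)) (λ where
           (zero  , e) → inj₁ e
           (suc i , e) → inj₂ (i , e)) ⟩
    Pr (λ x → E? zero x ⊎-dec Fin.any? (λ i → E? (suc i) x))
      ≤⟨ Pr-∪ (E? zero) (λ x → Fin.any? (λ i → E? (suc i) x)) ⟩
    Pr (E? zero) + Pr (λ x → Fin.any? (λ i → E? (suc i) x))
      ≤⟨ ℚ.+-mono-≤ (Pr≤b zero) (Pr-∃ (E? ∘ suc) (Pr≤b ∘ suc)) ⟩
    b + + m / 1 * b
      ≡⟨ cong (_+ (+ m / 1 * b)) (ℚ.*-identityˡ b) ⟨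
    1ℚ * b + + m / 1 * b
      ≡⟨ ℚ.*-distribʳ-+ b 1ℚ (+ m / 1) ⟨
    (+ 1 / 1 + + m / 1) * b
      ≡⟨ cong (_* b) (m/1+n/1 1 m) ⟩
    + suc m / 1 * b
      ∎
    where open ℚ.≤-Reasoning

  -- If `D`, which does not depend on the outcome, fails, then the event is empty. Hence `D` may be
  -- assumed while bounding; this supplies the distinctness of nodes and of keys.
  Pr-given : {D : Set} (E? : Decidable E) → Dec D → (∀ {x} → E x → D) →
             ∀ {b} → 0ℚ ≤ b → (D → Pr E? ≤ b) → Pr E? ≤ b
  Pr-given E? (yes d) E⇒D 0≤b bound = bound d
  Pr-given E? (no ¬d) E⇒D 0≤b bound = ℚ.≤-trans (ℚ.≤-reflexive (Pr-∅ E? (¬d ∘ E⇒D))) 0≤b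

-- Counting subsets by size and by prescribed members.

∣insertAt-inside∣ : (S : Subset n) (x : Fin (suc n)) → ∣ insertAt S x inside ∣ ≡ suc ∣ S ∣
∣insertAt-inside∣ S             zero    = refl
∣insertAt-inside∣ (inside  ∷ S) (suc x) = cong suc (∣insertAt-inside∣ S x)
∣insertAt-inside∣ (outside ∷ S) (suc x) = ∣insertAt-inside∣ S x

-- Splitting on whether the first key is a member reproduces Pascal's rule.
∑-subsets-∣∣≡k : ∀ c p k → ∑ (subsets p) (λ S → if does (∣ S ∣ ℕ.≟ k) then c else 0ℚ) ≡ + (p C k) / 1 * c
∑-subsets-∣∣≡k c zero    zero    = trans (ℚ.+-identityʳ c) (sym (ℚ.*-identityˡ c))
∑-subsets-∣∣≡k c zero    (suc k) = trans (sym (ℚ.*-zeroˡ c))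
  (cong (λ z → + z / 1 * c) (sym (k>n⇒nCk≡0 {0} {suc k} (s≤s z≤n))))
∑-subsets-∣∣≡k c (suc p) k = trans (∑-cartesianProductWith _∷_ (inside ∷ outside ∷ []) (subsets p) _) (step k)
  where
  step : ∀ k →
    ∑ (subsets p) (λ S → if does (suc ∣ S ∣ ℕ.≟ k) then c else 0ℚ) +
    (∑ (subsets p) (λ S → if does (∣ S ∣ ℕ.≟ k) then c else 0ℚ) + 0ℚ) ≡ + (suc p C k) / 1 * c
  -- A set that contains the first key is not empty: `suc ∣ S ∣ ℕ.≟ 0` computes to a negative
  -- answer, so the first sum is literally a sum of zeros.
  step zero    = trans (cong₂ _+_ (∑-zero (subsets p)) (trans (ℚ.+-identityʳ _) (∑-subsets-∣∣≡k c p zero)))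
                   (ℚ.+-identityˡ (+ 1 / 1 * c))
  step (suc k) = begin
    _                                            ≡⟨ cong₂ _+_ (∑-subsets-∣∣≡k c p k) (trans (ℚ.+-identityʳ _) (∑-subsets-∣∣≡k c p (suc k))) ⟩
    + (p C k) / 1 * c + + (p C suc k) / 1 * c    ≡⟨ ℚ.*-distribʳ-+ c (+ (p C k) / 1) (+ (p C suc k) / 1) ⟨
    (+ (p C k) / 1 + + (p C suc k) / 1) * c      ≡⟨ cong (_* c) (m/1+n/1 (p C k) (p C suc k)) ⟩
    + (p C k ℕ.+ p C suc k) / 1 * c              ≡⟨ cong (λ z → + z / 1 * c) (nCk+nC[k+1]≡[n+1]C[k+1] p k) ⟩
    + (suc p C suc k) / 1 * c                    ∎
    where open ≡-Reasoning

-- Coordinate `x` is summed first, and only its value `inside` survives; what remains ranges over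
-- the subsets of the other `p` keys.
∑-subsets-∋ : ∀ {p} (x : Fin (suc p)) (f : Subset (suc p) → ℚ) →
  ∑ (subsets (suc p)) (λ S → if does (x ∈? S) then f S else 0ℚ) ≡
  ∑ (subsets p) (λ S → f (insertAt S x inside))
∑-subsets-∋ {p} x f = begin
  ∑ (subsets (suc p)) (λ S → if does (x ∈? S) then f S else 0ℚ)
    ≡⟨ ∑-tuples-insertAt (inside ∷ outside ∷ []) x _ ⟩
  ∑ (subsets p) (λ S → g inside S) + (∑ (subsets p) (λ S → g outside S) + 0ℚ)
    ≡⟨ cong₂ (λ a b → a + (b + 0ℚ)) (∑-cong (subsets p) g-inside)
         (trans (∑-cong (subsets p) g-outside) (∑-zero (subsets p))) ⟩
  ∑ (subsets p) (λ S → f (insertAt S x inside)) + 0ℚ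
    ≡⟨ ℚ.+-identityʳ _ ⟩
  ∑ (subsets p) (λ S → f (insertAt S x inside))
    ∎
  where
  open ≡-Reasoning
  g : Bool → Subset p → ℚ
  g b S = if does (x ∈? insertAt S x b) then f (insertAt S x b) else 0ℚ
  g-inside : ∀ S → g inside S ≡ f (insertAt S x inside)
  g-inside S rewrite dec-true (x ∈? insertAt S x inside)
    (lookup⇒[]= x (insertAt S x inside) (insertAt-lookup S x inside)) = refl
  g-outside : ∀ S → g outside S ≡ 0ℚ
  g-outside S rewrite dec-false (x ∈? insertAt S x outside)
    (λ x∈ → contradiction (trans (sym (insertAt-lookup S x outside)) ([]=⇒lookup x∈)) (λ ())) = refl

-- Independence of the key sets of distinct nodes.

module _ (θ : Params) where
  open Params θ

  0≤keyMass : ∀ S → 0ℚ ≤ keyMass θ S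
  0≤keyMass S with does (∣ S ∣ ℕ.≟ K)
  ... | true  = 0≤/ 1 (P C K) {{nCk≢0 K≤P}}
  ... | false = ℚ.≤-refl

  0≤mass : (ω : Outcome θ n) → 0ℚ ≤ mass θ ω
  0≤mass []      = 0≤/ 1 1
  0≤mass (S ∷ ω) = 0≤* (0≤keyMass S) (0≤mass ω)

  ∑-keyMass≡1 : ∑ (subsets P) (keyMass θ) ≡ 1ℚ
  ∑-keyMass≡1 = begin
    ∑ (subsets P) (keyMass θ)            ≡⟨ ∑-subsets-∣∣≡k (+ 1 / (P C K)) P K ⟩
    + (P C K) / 1 * (+ 1 / (P C K))      ≡⟨ /-*-/ (P C K) 1 1 (P C K) ⟩
    + ((P C K) ℕ.* 1) / (1 ℕ.* (P C K))  ≡⟨ /-cross-≡ ((P C K) ℕ.* 1) (1 ℕ.* (P C K)) 1 1 (ring (P C K)) ⟩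
    1ℚ                                   ∎
    where
    open ≡-Reasoning
    instance
      C≢0 : NonZero (P C K)
      C≢0 = nCk≢0 K≤P
      1*C≢0 : NonZero (1 ℕ.* (P C K))
      1*C≢0 = ℕ.m*n≢0 1 (P C K)
    ring : ∀ c → c ℕ.* 1 ℕ.* 1 ≡ 1 ℕ.* (1 ℕ.* c)
    ring = ℕ.solve-∀

  ∑-mass≡1 : ∀ n → ∑ (outcomes θ n) (mass θ) ≡ 1ℚ
  ∑-mass≡1 zero    = refl
  ∑-mass≡1 (suc n) = begin
    ∑ (outcomes θ (suc n)) (mass θ)
      ≡⟨ ∑-cartesianProductWith _∷_ (subsets P) (outcomes θ n) (mass θ) ⟩
    ∑ (subsets P) (λ S → ∑ (outcomes θ n) (λ ω → keyMass θ S * mass θ ω))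
      ≡⟨ ∑-cong (subsets P) (λ S → *-distribˡ-∑ (keyMass θ S) (outcomes θ n) (mass θ)) ⟨
    ∑ (subsets P) (λ S → keyMass θ S * ∑ (outcomes θ n) (mass θ))
      ≡⟨ ∑-cong (subsets P) (λ S → trans (cong (keyMass θ S *_) (∑-mass≡1 n)) (ℚ.*-identityʳ _)) ⟩
    ∑ (subsets P) (keyMass θ)
      ≡⟨ ∑-keyMass≡1 ⟩
    1ℚ
      ∎
    where open ≡-Reasoning

  mass-insertAt : (ω : Outcome θ n) (i : Fin (suc n)) (S : Subset P) →
                  mass θ (insertAt ω i S) ≡ keyMass θ S * mass θ ω
  mass-insertAt ω       zero    S = refl
  mass-insertAt (T ∷ ω) (suc i) S = trans (cong (keyMass θ T *_) (mass-insertAt ω i S))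
    (solve 3 (λ a b c → a :* (b :* c) := b :* (a :* c)) refl (keyMass θ T) (keyMass θ S) (mass θ ω))
    where open +-*-Solver

  module Key = FiniteMeasure (subsets P) (keyMass θ) 0≤keyMass
  module Graph n = FiniteMeasure (outcomes θ n) (mass θ) 0≤mass

  private variable
    A₁ A₂ A₃ : Pred (Subset P) 0ℓ

  -- With node `i` summed first, the mass factors and the double sum becomes a product. Only upper
  -- bounds are wanted, so it is enough that `F` implies the product event.
  ℙ-insertAt-≤ : {E : Pred (Outcome θ n) 0ℓ} {F : Pred (Outcome θ (suc n)) 0ℓ}
    (A? : Decidable A₁) (E? : Decidable E) (F? : Decidable F) (i : Fin (suc n)) →
    (∀ {S ω} → F (insertAt ω i S) → A₁ S × E ω) → ℙ θ F? ≤ Key.Pr A? * ℙ θ E?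
  ℙ-insertAt-≤ {n = n} A? E? F? i F⇒A×E = begin
    ℙ θ F?
      ≡⟨ ∑-tuples-insertAt (subsets P) i (λ ω → Graph.restrict (suc n) (does (F? ω)) ω) ⟩
    ∑ (subsets P) (λ S → ∑ (outcomes θ n) (λ ω → Graph.restrict (suc n) (does (F? (insertAt ω i S))) (insertAt ω i S)))
      ≤⟨ ∑-mono-≤ (subsets P) (λ S → ∑-mono-≤ (outcomes θ n) (pointwise S)) ⟩
    ∑ (subsets P) (λ S → ∑ (outcomes θ n) (λ ω → Key.restrict (does (A? S)) S * Graph.restrict n (does (E? ω)) ω))
      ≡⟨ ∑-cong (subsets P) (λ S → *-distribˡ-∑ (Key.restrict (does (A? S)) S) (outcomes θ n) _) ⟨
    ∑ (subsets P) (λ S → Key.restrict (does (A? S)) S * ℙ θ E?)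
      ≡⟨ *-distribʳ-∑ (ℙ θ E?) (subsets P) _ ⟨
    Key.Pr A? * ℙ θ E?
      ∎
    where
    open ℚ.≤-Reasoning
    pointwise : ∀ S ω → Graph.restrict (suc n) (does (F? (insertAt ω i S))) (insertAt ω i S) ≤
                        Key.restrict (does (A? S)) S * Graph.restrict n (does (E? ω)) ω
    pointwise S ω with F? (insertAt ω i S)
    ... | no  _ = 0≤* (Key.0≤restrict (does (A? S)) S) (Graph.0≤restrict n (does (E? ω)) ω)
    ... | yes f rewrite dec-true (A? S) (proj₁ (F⇒A×E f)) | dec-true (E? ω) (proj₂ (F⇒A×E f)) =
      ℚ.≤-reflexive (mass-insertAt ω i S)

  -- The remaining nodes are given the sure event `⊤`, whose factor is the total mass 1.
  ℙ-one : (A? : Decidable A₁) (i : Fin n) → ℙ θ (λ ω → A? (lookup ω i)) ≤ Key.Pr A?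
  ℙ-one {A₁ = A₁} {n = suc n} A? i = subst (ℙ θ (λ ω → A? (lookup ω i)) ≤_)
    (trans (cong (Key.Pr A? *_) (∑-mass≡1 n)) (ℚ.*-identityʳ _))
    (ℙ-insertAt-≤ {E = λ _ → ⊤} A? (λ _ → yes tt) (λ ω → A? (lookup ω i)) i
      (λ {S} {ω} a → subst A₁ (insertAt-lookup ω i S) a , tt))

  ℙ-two : (A? : Decidable A₁) (B? : Decidable A₂) {i j : Fin n} → i ≢ j →
    ℙ θ (λ ω → A? (lookup ω i) ×-dec B? (lookup ω j)) ≤ Key.Pr A? * Key.Pr B?
  ℙ-two {A₁ = A₁} {A₂} {n = suc n} A? B? {i} {j} i≢j = ℚ.≤-trans
    (ℙ-insertAt-≤ A? (λ ω → B? (lookup ω (punchOut i≢j)))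
      (λ ω → A? (lookup ω i) ×-dec B? (lookup ω j)) i
      (λ {S} {ω} (a , b) → subst A₁ (insertAt-lookup ω i S) a ,
                           subst A₂ (lookup-insertAt-≢ ω S i≢j) b))
    (*-mono-≤ (Graph.0≤Pr n (λ ω → B? (lookup ω (punchOut i≢j)))) (Key.0≤Pr A?) ℚ.≤-refl
      (ℙ-one B? (punchOut i≢j)))

  ℙ-three : (A? : Decidable A₁) (B? : Decidable A₂) (C? : Decidable A₃) {i j k : Fin n} →
    i ≢ j → j ≢ k → i ≢ k →
    ℙ θ (λ ω → A? (lookup ω i) ×-dec B? (lookup ω j) ×-dec C? (lookup ω k)) ≤
    Key.Pr A? * (Key.Pr B? * Key.Pr C?)
  ℙ-three {A₁ = A₁} {A₂} {A₃} {n = suc n} A? B? C? {i} {j} {k} i≢j j≢k i≢k = ℚ.≤-trans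
    (ℙ-insertAt-≤ A? BC? (λ ω → A? (lookup ω i) ×-dec B? (lookup ω j) ×-dec C? (lookup ω k)) i
      (λ {S} {ω} (a , b , c) → subst A₁ (insertAt-lookup ω i S) a ,
                               subst A₂ (lookup-insertAt-≢ ω S i≢j) b ,
                               subst A₃ (lookup-insertAt-≢ ω S i≢k) c))
    (*-mono-≤ (Graph.0≤Pr n BC?) (Key.0≤Pr A?) ℚ.≤-refl
      -- After node `i` is deleted, `j` and `k` are renumbered by `punchOut`; they stay distinct
      -- because it is injective.
      (ℙ-two B? C? (j≢k ∘ Fin.punchOut-injective i≢j i≢k)))
    where
    BC? : Decidable (λ ω → A₂ (lookup ω (punchOut i≢j)) × A₃ (lookup ω (punchOut i≢k)))
    BC? ω = B? (lookup ω (punchOut i≢j)) ×-dec C? (lookup ω (punchOut i≢k))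

-- Probability that a node holds one or two given keys.

a/1*1/b≤c/d : ∀ a b c d .{{_ : NonZero b}} .{{_ : NonZero d}} →
        a ℕ.* d ℕ.≤ c ℕ.* b → + a / 1 * (+ 1 / b) ≤ + c / d
a/1*1/b≤c/d a b@(suc b′) c d ad≤cb = ℚ.≤-trans
  (ℚ.≤-reflexive (/-*-/ a 1 1 b))
  (/-mono-≤ (a ℕ.* 1) (1 ℕ.* b) c d
    (subst₂ (λ x y → x ℕ.* d ℕ.≤ c ℕ.* y) (sym (ℕ.*-identityʳ a)) (sym (ℕ.*-identityˡ b)) ad≤cb))

density : Params → ℚ
density θ = + K / P where open Params θ

0≤density : ∀ θ → 0ℚ ≤ density θ
0≤density θ = 0≤/ K P where open Params θ

-- A `suc k`-element set holding `x` amounts to a `k`-element set of the other `p` keys, and the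
-- ratio of the two binomial coefficients is given by absorption.
Pr-∋ : ∀ θ (x : Fin (Params.P θ)) → Key.Pr θ (x ∈?_) ≤ density θ
Pr-∋ θ@(mkParams (suc k) (suc p) K≤P) x = begin
  Key.Pr θ (x ∈?_)
    ≡⟨ ∑-subsets-∋ x (keyMass θ) ⟩
  ∑ (subsets p) (λ S → keyMass θ (insertAt S x inside))
    ≡⟨ ∑-cong (subsets p) (λ S → cong (λ m → if does (m ℕ.≟ suc k) then c else 0ℚ) (∣insertAt-inside∣ S x)) ⟩
  ∑ (subsets p) (λ S → if does (∣ S ∣ ℕ.≟ k) then c else 0ℚ)
    ≡⟨ ∑-subsets-∣∣≡k c p k ⟩
  + (p C k) / 1 * c
    ≤⟨ a/1*1/b≤c/d (p C k) (suc p C suc k) (suc k) (suc p) (ℕ.≤-reflexive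
         (trans (ℕ.*-comm (p C k) (suc p)) (sym ([1+k]*[1+n]C[1+k]≡[1+n]*nCk p k)))) ⟩
  density θ
    ∎
  where
  open ℚ.≤-Reasoning
  instance
    C≢0 : NonZero (suc p C suc k)
    C≢0 = nCk≢0 K≤P
  c = + 1 / (suc p C suc k)

-- This is `∑-subsets-∋` applied twice; once `x` is deleted, `y` becomes `punchOut x≢y`. The summand
-- depends on the set through its size alone, so each deletion merely shifts the argument of `g` by
-- one.
∑-subsets-∋∋ : ∀ {p} {x y : Fin (suc (suc p))} → x ≢ y → (g : ℕ → ℚ) →
  ∑ (subsets (suc (suc p))) (λ S → if does (x ∈? S ×-dec y ∈? S) then g ∣ S ∣ else 0ℚ) ≡
  ∑ (subsets p) (λ S → g (suc (suc ∣ S ∣)))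
∑-subsets-∋∋ {p} {x} {y} x≢y g = begin
  ∑ (subsets (suc (suc p))) (λ S → if does (x ∈? S ×-dec y ∈? S) then g ∣ S ∣ else 0ℚ)
    ≡⟨ ∑-cong (subsets (suc (suc p))) curry-if ⟩
  ∑ (subsets (suc (suc p))) (λ S → if does (x ∈? S) then (if does (y ∈? S) then g ∣ S ∣ else 0ℚ) else 0ℚ)
    ≡⟨ ∑-subsets-∋ x _ ⟩
  ∑ (subsets (suc p)) (λ S → if does (y ∈? insertAt S x inside) then g ∣ insertAt S x inside ∣ else 0ℚ)
    ≡⟨ ∑-cong (subsets (suc p)) (λ S → cong₂ (λ b m → if b then g m else 0ℚ)
         (does-⇔ (∈-insertAt S) (y ∈? insertAt S x inside) (y′ ∈? S)) (∣insertAt-inside∣ S x)) ⟩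
  ∑ (subsets (suc p)) (λ S → if does (y′ ∈? S) then g (suc ∣ S ∣) else 0ℚ)
    ≡⟨ ∑-subsets-∋ y′ (λ S → g (suc ∣ S ∣)) ⟩
  ∑ (subsets p) (λ S → g (suc ∣ insertAt S y′ inside ∣))
    ≡⟨ ∑-cong (subsets p) (λ S → cong (g ∘ suc) (∣insertAt-inside∣ S y′)) ⟩
  ∑ (subsets p) (λ S → g (suc (suc ∣ S ∣)))
    ∎
  where
  open ≡-Reasoning
  y′ = punchOut x≢y
  curry-if : ∀ S → (if does (x ∈? S ×-dec y ∈? S) then g ∣ S ∣ else 0ℚ) ≡
                   (if does (x ∈? S) then (if does (y ∈? S) then g ∣ S ∣ else 0ℚ) else 0ℚ)
  curry-if S with does (x ∈? S)
  ... | true  = refl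
  ... | false = refl
  ∈-insertAt : ∀ S → (y ∈ insertAt S x inside) ⇔ (y′ ∈ S)
  ∈-insertAt S = mk⇔
    (λ y∈ → lookup⇒[]= y′ S (trans (sym (lookup-insertAt-≢ S inside x≢y)) ([]=⇒lookup y∈)))
    (λ y∈ → lookup⇒[]= y (insertAt S x inside) (trans (lookup-insertAt-≢ S inside x≢y) ([]=⇒lookup y∈)))

-- With K = 2 + k and P = 2 + n this is C(P-2, K-2) / C(P, K) ≤ (K/P)² in cross-multiplied form.
-- Absorption is used twice; in between, the copy of `a` that it does not reach is enlarged to `b`,
-- which completes 1 + k copies of `b` to 2 + k.
nCk*[2+n]²≤[2+k]²*[2+n]C[2+k] : ∀ n k →
  (n C k) ℕ.* ((2 ℕ.+ n) ℕ.* (2 ℕ.+ n)) ℕ.≤ (2 ℕ.+ k) ℕ.* (2 ℕ.+ k) ℕ.* ((2 ℕ.+ n) C (2 ℕ.+ k))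
nCk*[2+n]²≤[2+k]²*[2+n]C[2+k] n k = begin
  a ℕ.* ((2 ℕ.+ n) ℕ.* (2 ℕ.+ n))
    ≡⟨ ring₁ a n ⟩
  (2 ℕ.+ n) ℕ.* (a ℕ.+ (1 ℕ.+ n) ℕ.* a)
    ≡⟨ cong (λ z → (2 ℕ.+ n) ℕ.* (a ℕ.+ z)) ([1+k]*[1+n]C[1+k]≡[1+n]*nCk n k) ⟨
  (2 ℕ.+ n) ℕ.* (a ℕ.+ (1 ℕ.+ k) ℕ.* b)
    ≤⟨ ℕ.*-monoʳ-≤ (2 ℕ.+ n) (ℕ.+-monoˡ-≤ ((1 ℕ.+ k) ℕ.* b) a≤b) ⟩
  (2 ℕ.+ n) ℕ.* (b ℕ.+ (1 ℕ.+ k) ℕ.* b)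
    ≡⟨ ring₂ b n k ⟩
  (2 ℕ.+ k) ℕ.* ((2 ℕ.+ n) ℕ.* b)
    ≡⟨ cong ((2 ℕ.+ k) ℕ.*_) ([1+k]*[1+n]C[1+k]≡[1+n]*nCk (suc n) (suc k)) ⟨
  (2 ℕ.+ k) ℕ.* ((2 ℕ.+ k) ℕ.* ((2 ℕ.+ n) C (2 ℕ.+ k)))
    ≡⟨ ℕ.*-assoc (2 ℕ.+ k) (2 ℕ.+ k) ((2 ℕ.+ n) C (2 ℕ.+ k)) ⟨
  (2 ℕ.+ k) ℕ.* (2 ℕ.+ k) ℕ.* ((2 ℕ.+ n) C (2 ℕ.+ k))
    ∎
  where
  open ℕ.≤-Reasoning
  a = n C k
  b = suc n C suc k
  a≤b : a ℕ.≤ b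
  a≤b = subst (a ℕ.≤_) (nCk+nC[k+1]≡[n+1]C[k+1] n k) (ℕ.m≤m+n a (n C suc k))
  ring₁ : ∀ a n → a ℕ.* ((2 ℕ.+ n) ℕ.* (2 ℕ.+ n)) ≡ (2 ℕ.+ n) ℕ.* (a ℕ.+ (1 ℕ.+ n) ℕ.* a)
  ring₁ = ℕ.solve-∀
  ring₂ : ∀ b n k → (2 ℕ.+ n) ℕ.* (b ℕ.+ (1 ℕ.+ k) ℕ.* b) ≡ (2 ℕ.+ k) ℕ.* ((2 ℕ.+ n) ℕ.* b)
  ring₂ = ℕ.solve-∀

both∈? : ∀ {p} (x y : Fin p) → Decidable (λ S → x ∈ S × y ∈ S)
both∈? x y S = x ∈? S ×-dec y ∈? S

-- Drawing without replacement makes the two memberships at most as likely together as if they were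
-- independent. The small values of `P` and `K` are treated apart so that two keys can be removed
-- from both.
Pr-∋∋ : ∀ θ {x y : Fin (Params.P θ)} → x ≢ y →
        Key.Pr θ (both∈? x y) ≤ density θ * density θ
Pr-∋∋ (mkParams K 1 K≤P) {zero} {zero} x≢y = contradiction refl x≢y
-- A one-element set cannot hold two keys: after the shift by two, the size test against 1 fails by
-- computation.
Pr-∋∋ θ@(mkParams 1 (suc (suc p)) K≤P) {x} {y} x≢y = begin
  Key.Pr θ (both∈? x y)                     ≡⟨ ∑-subsets-∋∋ x≢y (λ m → if does (m ℕ.≟ 1) then c else 0ℚ) ⟩
  ∑ (subsets p) (λ _ → 0ℚ)       ≡⟨ ∑-zero (subsets p) ⟩
  0ℚ                             ≤⟨ 0≤* (0≤density θ) (0≤density θ) ⟩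
  density θ * density θ          ∎
  where
  open ℚ.≤-Reasoning
  instance
    C≢0 : NonZero (suc (suc p) C 1)
    C≢0 = nCk≢0 K≤P
  c = + 1 / (suc (suc p) C 1)
Pr-∋∋ θ@(mkParams K@(suc (suc k)) P@(suc (suc p)) K≤P) {x} {y} x≢y = begin
  Key.Pr θ (both∈? x y)
    ≡⟨ ∑-subsets-∋∋ x≢y (λ m → if does (m ℕ.≟ K) then c else 0ℚ) ⟩
  ∑ (subsets p) (λ S → if does (∣ S ∣ ℕ.≟ k) then c else 0ℚ)
    ≡⟨ ∑-subsets-∣∣≡k c p k ⟩
  + (p C k) / 1 * c
    ≤⟨ a/1*1/b≤c/d (p C k) (P C K) (K ℕ.* K) (P ℕ.* P) (nCk*[2+n]²≤[2+k]²*[2+n]C[2+k] p k) ⟩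
  + (K ℕ.* K) / (P ℕ.* P)
    ≡⟨ /-*-/ K P K P ⟨
  density θ * density θ
    ∎
  where
  open ℚ.≤-Reasoning
  instance
    C≢0 : NonZero (P C K)
    C≢0 = nCk≢0 K≤P
  c = + 1 / (P C K)

-- The left side is the form in which the union bounds arrive: a factor `u` for each free key, and a
-- factor `q` or `r` for each node. The second term regroups into the cube of P (K/P)² = K²/P.
τ-density : ∀ θ → let u = + Params.P θ / 1; q = density θ; r = q * q in
  u * (q * (q * q)) + u * (u * (u * (r * (r * r)))) ≡ τ θ
τ-density θ@(mkParams K P@(suc _) K≤P) = cong₂ _+_ common pairwise
  where
  open ≡-Reasoning
  u = + P / 1
  q = density θ
  instance
    P²≢0 : NonZero (P ℕ.^ 2)
    P²≢0 = ℕ.m^n≢0 P 2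
  common : u * (q * (q * q)) ≡ + (K ℕ.^ 3) / (P ℕ.^ 2)
  common = begin
    u * (q * (q * q))
      ≡⟨ cong (u *_) (trans (cong (q *_) (/-*-/ K P K P)) (/-*-/ K P (K ℕ.* K) (P ℕ.* P))) ⟩
    u * (+ (K ℕ.* (K ℕ.* K)) / (P ℕ.* (P ℕ.* P)))
      ≡⟨ /-*-/ P 1 (K ℕ.* (K ℕ.* K)) (P ℕ.* (P ℕ.* P)) ⟩
    + (P ℕ.* (K ℕ.* (K ℕ.* K))) / (1 ℕ.* (P ℕ.* (P ℕ.* P)))
      ≡⟨ /-cross-≡ (P ℕ.* (K ℕ.* (K ℕ.* K))) (1 ℕ.* (P ℕ.* (P ℕ.* P))) (K ℕ.^ 3) (P ℕ.^ 2) (ring K P) ⟩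
    + (K ℕ.^ 3) / (P ℕ.^ 2)
      ∎
    where
    ring : ∀ k p → p ℕ.* (k ℕ.* (k ℕ.* k)) ℕ.* (p ℕ.* (p ℕ.* 1)) ≡
                   k ℕ.* (k ℕ.* (k ℕ.* 1)) ℕ.* (1 ℕ.* (p ℕ.* (p ℕ.* p)))
    ring = ℕ.solve-∀
  edge : u * (q * q) ≡ + (K ℕ.^ 2) / P
  edge = begin
    u * (q * q)
      ≡⟨ cong (u *_) (/-*-/ K P K P) ⟩
    u * (+ (K ℕ.* K) / (P ℕ.* P))
      ≡⟨ /-*-/ P 1 (K ℕ.* K) (P ℕ.* P) ⟩
    + (P ℕ.* (K ℕ.* K)) / (1 ℕ.* (P ℕ.* P))
      ≡⟨ /-cross-≡ (P ℕ.* (K ℕ.* K)) (1 ℕ.* (P ℕ.* P)) (K ℕ.^ 2) P (ring K P) ⟩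
    + (K ℕ.^ 2) / P
      ∎
    where
    ring : ∀ k p → p ℕ.* (k ℕ.* k) ℕ.* p ≡ k ℕ.* (k ℕ.* 1) ℕ.* (1 ℕ.* (p ℕ.* p))
    ring = ℕ.solve-∀
  pairwise : u * (u * (u * (q * q * (q * q * (q * q))))) ≡ (+ (K ℕ.^ 2) / P) ^ 3
  pairwise = trans
    -- The power `_^ 3` unfolds to a product ending in `1ℚ`, hence the `con 1ℚ`.
    (solve 2 (λ u q → u :* (u :* (u :* (q :* q :* (q :* q :* (q :* q))))) :=
                      u :* (q :* q) :* (u :* (q :* q) :* (u :* (q :* q) :* con 1ℚ))) refl u q)
    (cong (_^ 3) edge)
    where open +-*-Solver using (solve; _:*_; _:=_; con)

-- Triangles on given nodes and the union bound over triples.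

distinct? : (x y z : Fin m) → Dec (x ≢ y × y ≢ z × x ≢ z)
distinct? x y z = ¬? (x Fin.≟ y) ×-dec ¬? (y Fin.≟ z) ×-dec ¬? (x Fin.≟ z)

module _ (θ : Params) (n : ℕ) where
  open Params θ
  open Graph θ n

  commonKey? : (i j k : Fin n) (x : Fin P) →
    Decidable (λ (ω : Outcome θ n) → x ∈ lookup ω i × x ∈ lookup ω j × x ∈ lookup ω k)
  commonKey? i j k x ω = x ∈? lookup ω i ×-dec x ∈? lookup ω j ×-dec x ∈? lookup ω k

  -- The keys `x`, `y`, `z` witness the edges ij, jk, ik. The six memberships are grouped by node
  -- and not by edge, so that the event is a conjunction of conditions on independent key sets.
  EdgeKeys : (i j k : Fin n) (x y z : Fin P) → Pred (Outcome θ n) 0ℓ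
  EdgeKeys i j k x y z ω =
    (x ∈ lookup ω i × z ∈ lookup ω i) ×
    (x ∈ lookup ω j × y ∈ lookup ω j) ×
    (y ∈ lookup ω k × z ∈ lookup ω k)

  edgeKeys? : (i j k : Fin n) (x y z : Fin P) → Decidable (EdgeKeys i j k x y z)
  edgeKeys? i j k x y z ω =
    both∈? x z (lookup ω i) ×-dec both∈? x y (lookup ω j) ×-dec both∈? y z (lookup ω k)

  -- Distinctness belongs to the event because the bound `r` for a pair of keys at one node comes
  -- from `Pr-∋∋`, which requires two different keys.
  distinctEdgeKeys? : (i j k : Fin n) (x y z : Fin P) →
    Decidable (λ ω → (x ≢ y × y ≢ z × x ≢ z) × EdgeKeys i j k x y z ω)
  distinctEdgeKeys? i j k x y z ω = distinct? x y z ×-dec edgeKeys? i j k x y z ω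

  triangleAt? : (i j k : Fin n) →
    Decidable (λ (ω : Outcome θ n) → KeyGraph ω i j × KeyGraph ω j k × KeyGraph ω i k)
  triangleAt? i j k ω = keyGraph? ω i j ×-dec keyGraph? ω j k ×-dec keyGraph? ω i k

  ∃commonKey? : (i j k : Fin n) → Decidable _
  ∃commonKey? i j k ω = Fin.any? λ x → commonKey? i j k x ω

  ∃edgeKeys? : (i j k : Fin n) → Decidable _
  ∃edgeKeys? i j k ω = Fin.any? λ x → Fin.any? λ y → Fin.any? λ z → distinctEdgeKeys? i j k x y z ω

  private
    q = density θ
    r = q * q
    u = + P / 1
    v = + n / 1

    0≤q : 0ℚ ≤ q
    0≤q = 0≤density θ

    0≤r : 0ℚ ≤ r
    0≤r = 0≤* 0≤q 0≤q

    0≤u : 0ℚ ≤ u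
    0≤u = 0≤/ P 1

  0≤τ : 0ℚ ≤ τ θ
  0≤τ = subst (0ℚ ≤_) (τ-density θ) (0≤+ (0≤* 0≤u (0≤* 0≤q 0≤r))
    (0≤* 0≤u (0≤* 0≤u (0≤* 0≤u (0≤* 0≤r (0≤* 0≤r 0≤r))))))

  module _ {i j k : Fin n} (i≢j : i ≢ j) (j≢k : j ≢ k) (i≢k : i ≢ k) where

    Pr-commonKey : ∀ x → Pr (commonKey? i j k x) ≤ q * (q * q)
    Pr-commonKey x = ℚ.≤-trans (ℙ-three θ (x ∈?_) (x ∈?_) (x ∈?_) i≢j j≢k i≢k)
      (*-mono-≤ (0≤* 0≤Pr∋ 0≤Pr∋) 0≤q (Pr-∋ θ x) (*-mono-≤ 0≤Pr∋ 0≤q (Pr-∋ θ x) (Pr-∋ θ x)))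
      where
      0≤Pr∋ : 0ℚ ≤ Key.Pr θ (x ∈?_)
      0≤Pr∋ = Key.0≤Pr θ (x ∈?_)

    Pr-edgeKeys : ∀ {x y z} → x ≢ y → y ≢ z → x ≢ z → Pr (edgeKeys? i j k x y z) ≤ r * (r * r)
    Pr-edgeKeys {x} {y} {z} x≢y y≢z x≢z = ℚ.≤-trans
      (ℙ-three θ (both∈? x z) (both∈? x y) (both∈? y z) i≢j j≢k i≢k)
      (*-mono-≤ (0≤* (Key.0≤Pr θ (both∈? x y)) (Key.0≤Pr θ (both∈? y z))) 0≤r (Pr-∋∋ θ x≢z)
        (*-mono-≤ (Key.0≤Pr θ (both∈? y z)) 0≤r (Pr-∋∋ θ x≢y) (Pr-∋∋ θ y≢z)))

    Pr-distinctEdgeKeys : ∀ x y z → Pr (distinctEdgeKeys? i j k x y z) ≤ r * (r * r)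
    Pr-distinctEdgeKeys x y z =
      Pr-given (distinctEdgeKeys? i j k x y z) (distinct? x y z) proj₁ (0≤* 0≤r (0≤* 0≤r 0≤r))
        λ (x≢y , y≢z , x≢z) → ℚ.≤-trans
          (Pr-mono (distinctEdgeKeys? i j k x y z) (edgeKeys? i j k x y z) proj₂)
          (Pr-edgeKeys x≢y y≢z x≢z)

    Pr-∃commonKey : Pr (∃commonKey? i j k) ≤ u * (q * (q * q))
    Pr-∃commonKey = Pr-∃ (commonKey? i j k) Pr-commonKey

    Pr-∃edgeKeys : Pr (∃edgeKeys? i j k) ≤ u * (u * (u * (r * (r * r))))
    Pr-∃edgeKeys =
      Pr-∃ (λ x ω → Fin.any? λ y → Fin.any? λ z → distinctEdgeKeys? i j k x y z ω) λ x →
      Pr-∃ (λ y ω → Fin.any? λ z → distinctEdgeKeys? i j k x y z ω) λ y →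
      Pr-∃ (λ z → distinctEdgeKeys? i j k x y z) λ z →
      Pr-distinctEdgeKeys x y z

  -- The edges of a triangle are witnessed by three keys; if two of the keys
  -- coincide, then that key is held by all three nodes.
  triangle-keys : ∀ {i j k} ω → KeyGraph ω i j × KeyGraph ω j k × KeyGraph ω i k →
    (∃[ x ] x ∈ lookup ω i × x ∈ lookup ω j × x ∈ lookup ω k) ⊎
    (∃[ x ] ∃[ y ] ∃[ z ] (x ≢ y × y ≢ z × x ≢ z) × EdgeKeys i j k x y z ω)
  triangle-keys {i} {j} {k} ω ((_ , x , x∈ij) , (_ , y , y∈jk) , (_ , z , z∈ik))
    with x∈p∩q⁻ (lookup ω i) (lookup ω j) x∈ij
       | x∈p∩q⁻ (lookup ω j) (lookup ω k) y∈jk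
       | x∈p∩q⁻ (lookup ω i) (lookup ω k) z∈ik
       | x Fin.≟ y | y Fin.≟ z | x Fin.≟ z
  ... | x∈i , x∈j | y∈j , y∈k | z∈i , z∈k | yes refl | _ | _ = inj₁ (x , x∈i , x∈j , y∈k)
  ... | x∈i , x∈j | y∈j , y∈k | z∈i , z∈k | no _ | yes refl | _ = inj₁ (y , z∈i , y∈j , y∈k)
  ... | x∈i , x∈j | y∈j , y∈k | z∈i , z∈k | no _ | no _ | yes refl = inj₁ (x , x∈i , x∈j , z∈k)
  ... | x∈i , x∈j | y∈j , y∈k | z∈i , z∈k | no x≢y | no y≢z | no x≢z =
    inj₂ (x , y , z , (x≢y , y≢z , x≢z) , (x∈i , z∈i) , (x∈j , y∈j) , (y∈k , z∈k))

  Pr-triangleAt≤τ : (i j k : Fin n) → Pr (triangleAt? i j k) ≤ τ θ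
  -- Adjacency in `KeyGraph` includes distinctness of the endpoints, so for coinciding nodes the
  -- event is empty and `0≤τ` suffices.
  Pr-triangleAt≤τ i j k = Pr-given (triangleAt? i j k) (distinct? i j k)
    (λ ((i≢j , _) , (j≢k , _) , (i≢k , _)) → i≢j , j≢k , i≢k) 0≤τ
    λ (i≢j , j≢k , i≢k) → begin
      Pr (triangleAt? i j k)
        ≤⟨ Pr-mono (triangleAt? i j k) (λ ω → ∃commonKey? i j k ω ⊎-dec ∃edgeKeys? i j k ω) (λ {ω} → triangle-keys ω) ⟩
      Pr (λ ω → ∃commonKey? i j k ω ⊎-dec ∃edgeKeys? i j k ω)
        ≤⟨ Pr-∪ (∃commonKey? i j k) (∃edgeKeys? i j k) ⟩
      Pr (∃commonKey? i j k) + Pr (∃edgeKeys? i j k)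
        ≤⟨ ℚ.+-mono-≤ (Pr-∃commonKey i≢j j≢k i≢k) (Pr-∃edgeKeys i≢j j≢k i≢k) ⟩
      u * (q * (q * q)) + u * (u * (u * (r * (r * r))))
        ≡⟨ τ-density θ ⟩
      τ θ
        ∎
    where open ℚ.≤-Reasoning

  ℙ[triangle]≤n³τ : ℙ[triangle] n θ ≤ + (n ℕ.^ 3) / 1 * τ θ
  ℙ[triangle]≤n³τ = begin
    ℙ[triangle] n θ
      -- `hasTriangle?` unfolds to three nested `Fin.any?` around `triangleAt?`, and each of them
      -- costs a factor `v`, that is, n.
      ≤⟨ Pr-∃ (λ i ω → Fin.any? λ j → Fin.any? λ k → triangleAt? i j k ω) (λ i →
         Pr-∃ (λ j ω → Fin.any? λ k → triangleAt? i j k ω) λ j →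
         Pr-∃ (λ k → triangleAt? i j k) λ k →
         Pr-triangleAt≤τ i j k) ⟩
    v * (v * (v * τ θ))
      ≡⟨ solve 2 (λ v t → v :* (v :* (v :* t)) := v :* (v :* v) :* t) refl v (τ θ) ⟩
    v * (v * v) * τ θ
      ≡⟨ cong (_* τ θ) (trans (cong (v *_) (/-*-/ n 1 n 1)) (/-*-/ n 1 (n ℕ.* n) 1)) ⟩
    + (n ℕ.* (n ℕ.* n)) / 1 * τ θ
      ≡⟨ cong (λ z → + (n ℕ.* (n ℕ.* z)) / 1 * τ θ) (ℕ.*-identityʳ n) ⟨
    + (n ℕ.^ 3) / 1 * τ θ
      ∎
    where
    open ℚ.≤-Reasoning
    open +-*-Solver using (solve; _:*_; _:=_)

  0≤ℙ[triangle] : 0ℚ ≤ ℙ[triangle] n θ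
  0≤ℙ[triangle] = 0≤Pr (λ ω → hasTriangle? (keyGraph? ω))

-- Passage to the limit.

theorem3p1 : (s : Scaling) →
    (λ n 2≤n → (+ (n ℕ.^ 3) / 1) * τ (Scaling.θ s n 2≤n)) ConvergesTo 0ℚ →
    (λ n 2≤n → ℙ[triangle] n (Scaling.θ s n 2≤n)) ConvergesTo 0ℚ
-- The threshold that serves `ε` for n³τ serves it for the probability too, since 0 ≤ ℙ ≤ n³τ lets
-- the absolute values be dropped.
theorem3p1 s n³τ→0 ε 0<ε with n³τ→0 ε 0<ε
... | N , bound = N , λ n 2≤n N≤n →
  let θ = Scaling.θ s n 2≤n
      p = ℙ[triangle] n θ
      t = + (n ℕ.^ 3) / 1 * τ θ
      0≤p = 0≤ℙ[triangle] θ n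
      p≤t = ℙ[triangle]≤n³τ θ n
  in ℚ.≤-<-trans (subst₂ _≤_ (sym (∣q-0∣≡q 0≤p)) (sym (∣q-0∣≡q (ℚ.≤-trans 0≤p p≤t))) p≤t) (bound n 2≤n N≤n)
  where
  ∣q-0∣≡q : ∀ {q} → 0ℚ ≤ q → ℚ.∣ q ℚ.- 0ℚ ∣ ≡ q
  ∣q-0∣≡q {q} 0≤q = trans (cong ℚ.∣_∣ (ℚ.+-identityʳ q)) (ℚ.0≤p⇒∣p∣≡p 0≤q)
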